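{- Let $n_0,n_1$ be positive integers and $X=[n_0;n_1]=n_0+\tfrac{1}{n_1}$. Then $$\mathrm{F}([n_0;n_1]) = F_{n_0}F_{n_1}+F_{n_0-1}F_{n_1+1}.$$
   Context: The conumerator function is the unique map $\mathrm{con}:\mathbb{Q}_{>0}\to\mathbb{Z}_{>0}$ with $\mathrm{con}(1)=1$ and, for all $X\in\mathbb{Q}_{>0}$, $\mathrm{con}(1+X)=\mathrm{con}(X)+\mathrm{con}(1/X)$ and $\mathrm{con}\left(\tfrac{1}{1+X}\right)=\mathrm{con}(X)$. The codenominator function is $\mathrm{F}(X):=\mathrm{con}(1/X)$ for $X\in\mathbb{Q}_{>0}$; equivalently $\mathrm{F}(1)=1$, $\mathrm{F}(1+X)=\mathrm{F}(1/X)$, $\mathrm{F}\left(\tfrac{1}{1+X}\right)=\mathrm{F}(X)+\mathrm{F}(1/X)$. The Fibonacci numbers are $F_0=0$, $F_1=1$, $F_n=F_{n-1}+F_{n-2}$. -}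

module Defs where

open import Data.Empty using (⊥-elim-irr)
open import Data.Irrelevant using ([_])
open import Data.Integer using (+_; +[1+_])
import Data.Integer as ℤ
import Data.Integer.Properties as ℤₚ
import Data.Nat as ℕ
open import Data.Nat using (ℕ; zero; suc; NonZero; _+_; _≤_; s≤s; Ordering; less; equal; greater; compare)
open import Data.Nat.Coprimality using (Coprime; coprime-+) renaming (sym to coprime-sym)
open import Data.Nat.Properties
open import Data.Product using (_×_; _,_; proj₁; proj₂; ∃!)
open import Data.Rational using (ℚ; mkℚ; 1ℚ; Positive; toℚᵘ; fromℚᵘ)
import Data.Rational as ℚ
import Data.Rational.Properties as ℚₚ
open import Data.Rational.Unnormalised using (ℚᵘ; mkℚᵘ; 1ℚᵘ; _≃_; *≡*)
import Data.Rational.Unnormalised as ℚᵘ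
import Data.Rational.Unnormalised.Properties as ℚᵘₚ
open import Data.Refinement using (Refinement-syntax; value; value-injective) renaming (_,_ to _∣_)
open import Relation.Binary.PropositionalEquality
open import Relation.Nullary using (¬_)

ℚ>0 : Set
ℚ>0 = [ q ∈ ℚ ∣ Positive q ]

ℕ>0 : Set
ℕ>0 = [ n ∈ ℕ ∣ NonZero n ]

infixl 6 _+⁺_
infix 8 1/⁺_

1⁺ : ℚ>0
1⁺ = 1ℚ ∣ [ _ ]

_+⁺_ : ℚ>0 → ℚ>0 → ℚ>0
(p ∣ [ p>0 ]) +⁺ (q ∣ [ q>0 ]) = (p ℚ.+ q) ∣ [ ℚₚ.pos+pos⇒pos p {{p>0}} q {{q>0}} ]

1/⁺_ : ℚ>0 → ℚ>0
1/⁺ (p ∣ [ p>0 ]) = (ℚ.1/ p) {{ℚₚ.pos⇒nonZero p {{p>0}}}} ∣ [ ℚₚ.1/pos⇒pos p {{p>0}} ]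

fromℕ⁺ : (n : ℕ) .{{_ : NonZero n}} → ℚ>0
fromℕ⁺ n = (+ n ℚ./ 1) ∣ [ ℚₚ.normalize-pos n 1 ]

-- The continued fraction [n₀; n₁] = n₀ + 1/n₁.
[_⨾_] : (n₀ n₁ : ℕ) .{{_ : NonZero n₀}} .{{_ : NonZero n₁}} → ℚ>0
[ n₀ ⨾ n₁ ] = fromℕ⁺ n₀ +⁺ 1/⁺ fromℕ⁺ n₁

fib : ℕ → ℕ
fib 0 = 0
fib 1 = 1
fib (suc (suc n)) = fib (suc n) + fib n

record IsConumerator (f : ℚ>0 → ℕ>0) : Set where
  field
    at-1     : value (f 1⁺) ≡ 1
    at-1+    : ∀ X → value (f (1⁺ +⁺ X)) ≡ value (f X) + value (f (1/⁺ X))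
    at-1/1+  : ∀ X → value (f (1/⁺ (1⁺ +⁺ X))) ≡ value (f X)

private

  -- X ≐ p ╱ q says X = (p + 1) / (q + 1), not necessarily in lowest terms.
  _≐_╱_ : ℚ>0 → ℕ → ℕ → Set
  X ≐ p ╱ q = toℚᵘ (value X) ≃ mkℚᵘ +[1+ p ] q

  ≐-unique : ∀ {X Y p q} → X ≐ p ╱ q → Y ≐ p ╱ q → X ≡ Y
  ≐-unique x y = value-injective (ℚₚ.toℚᵘ-injective (ℚᵘₚ.≃-trans x (ℚᵘₚ.≃-sym y)))

  frac : ℕ → ℕ → ℚ>0
  frac p q = fromℚᵘ (mkℚᵘ +[1+ p ] q) ∣ [ ℚₚ.normalize-pos (suc p) (suc q) ]

  frac-≐ : ∀ p q → frac p q ≐ p ╱ q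
  frac-≐ p q = ℚₚ.toℚᵘ-fromℚᵘ (mkℚᵘ +[1+ p ] q)

  1-≐ : ∀ p → 1⁺ ≐ p ╱ p
  1-≐ p = *≡* (ℤₚ.*-comm (+ 1) +[1+ p ])

  1+-≐ : ∀ {X p q} → X ≐ p ╱ q → (1⁺ +⁺ X) ≐ suc (q + p) ╱ q
  1+-≐ {X} {p} {q} x = begin
    toℚᵘ (1ℚ ℚ.+ value X)          ≈⟨ ℚₚ.toℚᵘ-homo-+ 1ℚ (value X) ⟩
    1ℚᵘ ℚᵘ.+ toℚᵘ (value X)        ≈⟨ ℚᵘₚ.+-congʳ 1ℚᵘ x ⟩
    1ℚᵘ ℚᵘ.+ mkℚᵘ +[1+ p ] q       ≈⟨ *≡* (cong₂ ℤ._*_ num (cong +[1+_] (sym (+-identityʳ q)))) ⟩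
    mkℚᵘ +[1+ suc (q + p) ] q      ∎
    where
    open import Relation.Binary.Reasoning.Setoid ℚᵘₚ.≃-setoid
    num : + 1 ℤ.* +[1+ q ] ℤ.+ +[1+ p ] ℤ.* + 1 ≡ +[1+ suc (q + p) ]
    num = trans (cong₂ ℤ._+_ (ℤₚ.*-identityˡ +[1+ q ]) (ℤₚ.*-identityʳ +[1+ p ]))
                (cong +[1+_] (+-suc q p))

  ¬0>0 : ¬ ℤ.Positive (+ 0)
  ¬0>0 ()

  ¬neg>0 : ∀ {n} → ¬ ℤ.Positive ℤ.-[1+ n ]
  ¬neg>0 ()

  1/-≐ : ∀ {X p q} → X ≐ p ╱ q → (1/⁺ X) ≐ q ╱ p
  1/-≐ {mkℚ +[1+ m ] n _ ∣ _} {p} {q} (*≡* eq) =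
    *≡* (trans (ℤₚ.*-comm +[1+ n ] +[1+ p ]) (trans (sym eq) (ℤₚ.*-comm +[1+ m ] +[1+ q ])))
  1/-≐ {mkℚ (+ 0) _ _ ∣ [ x>0 ]} _ = ⊥-elim-irr (¬0>0 x>0)
  1/-≐ {mkℚ ℤ.-[1+ _ ] _ _ ∣ [ x>0 ]} _ = ⊥-elim-irr (¬neg>0 x>0)

  -- conᶠ k p q is con((p + 1) / (q + 1)); k bounds the number of recursive
  -- calls and is enough as soon as p + q < k.
  conᶠ : ℕ → ℕ → ℕ → ℕ
  conᶠ′ : ℕ → ∀ {p q} → Ordering p q → ℕ
  conᶠ zero    p q = 1
  conᶠ (suc k) p q = conᶠ′ k (compare p q)
  conᶠ′ k (equal p)     = 1
  conᶠ′ k (less p j)    = conᶠ k j p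
  conᶠ′ k (greater q j) = conᶠ k j q + conᶠ k q j

  conᶠ-pos : ∀ k p q → NonZero (conᶠ k p q)
  conᶠ-pos′ : ∀ k {p q} (o : Ordering p q) → NonZero (conᶠ′ k o)
  conᶠ-pos zero    p q = _
  conᶠ-pos (suc k) p q = conᶠ-pos′ k (compare p q)
  conᶠ-pos′ k (equal p)     = _
  conᶠ-pos′ k (less p j)    = conᶠ-pos k j p
  conᶠ-pos′ k (greater q j) with conᶠ k j q | conᶠ-pos k j q
  ... | suc _ | _ = _

  less-bound : ∀ {p j k} → p + suc (p + j) ℕ.< suc k → j + p ℕ.< k
  less-bound {p} {j} {k} (s≤s b) = ≤-trans (s≤s (≤-reflexive (+-comm j p)))
    (≤-trans (m≤n+m (suc (p + j)) p) b)

  greater-bound₂ : ∀ {q j k} → suc (q + j) + q ℕ.< suc k → q + j ℕ.< k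
  greater-bound₂ {q} {j} (s≤s b) = ≤-trans (m≤m+n (suc (q + j)) q) b

  greater-bound₁ : ∀ {q j k} → suc (q + j) + q ℕ.< suc k → j + q ℕ.< k
  greater-bound₁ {q} {j} {k} b = subst (ℕ._< k) (+-comm q j) (greater-bound₂ {q} b)

  conᶠ-stable : ∀ {k l p q} → p + q ℕ.< k → p + q ℕ.< l → conᶠ k p q ≡ conᶠ l p q
  conᶠ-stable′ : ∀ {k l p q} (o : Ordering p q) → p + q ℕ.< suc k → p + q ℕ.< suc l →
                 conᶠ′ k o ≡ conᶠ′ l o
  conᶠ-stable {suc k} {suc l} {p} {q} b c = conᶠ-stable′ (compare p q) b c
  conᶠ-stable′ (equal p)     b c = refl
  conᶠ-stable′ (less p j)    b c = conᶠ-stable (less-bound {p} b) (less-bound {p} c)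
  conᶠ-stable′ (greater q j) b c = cong₂ _+_
    (conᶠ-stable {p = j} (greater-bound₁ {q} b) (greater-bound₁ {q} c))
    (conᶠ-stable {p = q} (greater-bound₂ {q} b) (greater-bound₂ {q} c))

  compare-less : ∀ p j → compare p (suc (p + j)) ≡ less p j
  compare-less zero    j = refl
  compare-less (suc p) j rewrite compare-less p j = refl

  compare-greater : ∀ q j → compare (suc (q + j)) q ≡ greater q j
  compare-greater zero    j = refl
  compare-greater (suc q) j rewrite compare-greater q j = refl

  conᴺ : ℕ → ℕ → ℕ
  conᴺ p q = conᶠ (suc (p + q)) p q

  conᴺ-1+ : ∀ p q → conᴺ (suc (q + p)) q ≡ conᴺ p q + conᴺ q p
  conᴺ-1+ p q rewrite compare-greater q p = cong₂ _+_
    (conᶠ-stable {p = p} (greater-bound₁ {q} ≤-refl) ≤-refl)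
    (conᶠ-stable {p = q} (greater-bound₂ {q} ≤-refl) ≤-refl)

  conᴺ-1/1+ : ∀ p q → conᴺ q (suc (q + p)) ≡ conᴺ p q
  conᴺ-1/1+ p q rewrite compare-less q p = conᶠ-stable {p = p} (less-bound {q} ≤-refl) ≤-refl

  conᶜ : ℚ>0 → ℕ>0
  conᶜ (x ∣ _) = conᴺ p q ∣ [ conᶠ-pos (suc (p + q)) p q ]
    where
    p q : ℕ
    p = ℕ.pred ℤ.∣ ℚ.↥ x ∣
    q = ℚ.denominator-1 x

  conᶜ-≐ : ∀ {X p q} → .(Coprime (suc p) (suc q)) → X ≐ p ╱ q → value (conᶜ X) ≡ conᴺ p q
  conᶜ-≐ {X} {p} {q} c x = cong (λ Y → value (conᶜ Y))
    (≐-unique {X} {mkℚ +[1+ p ] q c ∣ [ _ ]} x (*≡* refl))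

  conᶜ-isConumerator : IsConumerator conᶜ
  conᶜ-isConumerator = record { at-1 = refl ; at-1+ = at-1+ ; at-1/1+ = at-1/1+ }
    where
    coprime-1+ : ∀ {p q} → Coprime (suc p) (suc q) → Coprime (suc (suc (q + p))) (suc q)
    coprime-1+ {p} {q} c = subst (λ n → Coprime n (suc q)) (cong suc (+-suc q p)) (coprime-+ c)

    at-1+ : ∀ X → value (conᶜ (1⁺ +⁺ X)) ≡ value (conᶜ X) + value (conᶜ (1/⁺ X))
    at-1+ X@(mkℚ +[1+ p ] q c ∣ _) =
      trans (conᶜ-≐ {1⁺ +⁺ X} (coprime-1+ c) (1+-≐ {X} (*≡* refl))) (conᴺ-1+ p q)
    at-1+ (mkℚ (+ 0) _ _ ∣ [ x>0 ]) = ⊥-elim-irr (¬0>0 x>0)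
    at-1+ (mkℚ ℤ.-[1+ _ ] _ _ ∣ [ x>0 ]) = ⊥-elim-irr (¬neg>0 x>0)

    at-1/1+ : ∀ X → value (conᶜ (1/⁺ (1⁺ +⁺ X))) ≡ value (conᶜ X)
    at-1/1+ X@(mkℚ +[1+ p ] q c ∣ _) =
      trans (conᶜ-≐ {1/⁺ (1⁺ +⁺ X)} (coprime-sym (coprime-1+ c))
              (1/-≐ {1⁺ +⁺ X} (1+-≐ {X} (*≡* refl))))
            (conᴺ-1/1+ p q)
    at-1/1+ (mkℚ (+ 0) _ _ ∣ [ x>0 ]) = ⊥-elim-irr (¬0>0 x>0)
    at-1/1+ (mkℚ ℤ.-[1+ _ ] _ _ ∣ [ x>0 ]) = ⊥-elim-irr (¬neg>0 x>0)

  module _ {f : ℚ>0 → ℕ>0} (f-con : IsConumerator f) where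
    open IsConumerator f-con

    determined : ∀ k {p q} X → p + q ℕ.< k → X ≐ p ╱ q → value (f X) ≡ conᶠ k p q
    determined′ : ∀ k {p q} (o : Ordering p q) X → p + q ℕ.< suc k → X ≐ p ╱ q →
                  value (f X) ≡ conᶠ′ k o
    determined (suc k) {p} {q} = determined′ k (compare p q)
    determined′ k (equal p) X b x = trans (cong (λ Y → value (f Y)) (≐-unique {X} x (1-≐ p))) at-1
    determined′ k (less p j) X b x = begin
      value (f X)                    ≡⟨ cong (λ Z → value (f Z)) (≐-unique {X} x (1/-≐ {1⁺ +⁺ Y} (1+-≐ {Y} y))) ⟩
      value (f (1/⁺ (1⁺ +⁺ Y)))      ≡⟨ at-1/1+ Y ⟩
      value (f Y)                    ≡⟨ determined k Y (less-bound {p} b) y ⟩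
      conᶠ k j p                     ∎
      where
      open ≡-Reasoning
      Y = frac j p
      y = frac-≐ j p
    determined′ k (greater q j) X b x = begin
      value (f X)                      ≡⟨ cong (λ Z → value (f Z)) (≐-unique {X} x (1+-≐ {Y} y)) ⟩
      value (f (1⁺ +⁺ Y))              ≡⟨ at-1+ Y ⟩
      value (f Y) + value (f (1/⁺ Y))  ≡⟨ cong₂ _+_ (determined k Y (greater-bound₁ {q} b) y)
                                                    (determined k (1/⁺ Y) (greater-bound₂ {q} b) (1/-≐ {Y} y)) ⟩
      conᶠ k j q + conᶠ k q j          ∎
      where
      open ≡-Reasoning
      Y = frac j q
      y = frac-≐ j q

  conᶜ-unique : ∀ {f} → IsConumerator f → conᶜ ≗ f
  conᶜ-unique f-con X@(mkℚ +[1+ p ] q _ ∣ _) =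
    value-injective (sym (determined f-con (suc (p + q)) X ≤-refl (*≡* refl)))
  conᶜ-unique f-con (mkℚ (+ 0) _ _ ∣ [ x>0 ]) = ⊥-elim-irr (¬0>0 x>0)
  conᶜ-unique f-con (mkℚ ℤ.-[1+ _ ] _ _ ∣ [ x>0 ]) = ⊥-elim-irr (¬neg>0 x>0)

∃!-conumerator : ∃! _≗_ IsConumerator
∃!-conumerator = conᶜ , conᶜ-isConumerator , conᶜ-unique

con : ℚ>0 → ℕ>0
con = proj₁ ∃!-conumerator

con-isConumerator : IsConumerator con
con-isConumerator = proj₁ (proj₂ ∃!-conumerator)

-- The codenominator; the Fibonacci numbers are fib.
F : ℚ>0 → ℕ>0
F X = con (1/⁺ X)

{-# OPTIONS --safe #-}
-- Adding 1 sends the pair (con X , F X) to (con X + F X , con X), which is one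
-- step of the Fibonacci recurrence, while inverting X swaps the pair.  Hence
-- adding an integer n₀ acts through Fibonacci coefficients, and the pair at
-- 1/n₁ is (fib n₁ , fib (n₁ + 1)).
module Submission where

open import Defs
open import Data.Integer using (+_)
import Data.Integer as ℤ
import Data.Integer.Properties as ℤₚ
open import Data.Irrelevant using ([_])
open import Data.Nat using (ℕ; zero; suc; NonZero; _+_; _*_; _∸_)
open import Data.Nat.Properties using (+-comm; +-identityʳ)
open import Data.Nat.Solver using (module +-*-Solver)
open import Data.Product using (_×_; _,_; proj₁; proj₂)
open import Data.Rational using (1ℚ; toℚᵘ)
import Data.Rational as ℚ
import Data.Rational.Properties as ℚₚ
open import Data.Rational.Unnormalised using (mkℚᵘ; 1ℚᵘ)
import Data.Rational.Unnormalised as ℚᵘ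
import Data.Rational.Unnormalised.Properties as ℚᵘₚ
open import Data.Refinement using (value; value-injective) renaming (_,_ to _∣_)
open import Relation.Binary.PropositionalEquality
  using (_≡_; refl; sym; trans; cong; cong₂; module ≡-Reasoning)
open +-*-Solver using (solve; _:+_; _:*_; _:=_)

+⁺-assoc : ∀ X Y Z → (X +⁺ Y) +⁺ Z ≡ X +⁺ (Y +⁺ Z)
+⁺-assoc X Y Z = value-injective (ℚₚ.+-assoc (value X) (value Y) (value Z))

1/⁺-involutive : ∀ X → 1/⁺ (1/⁺ X) ≡ X
1/⁺-involutive (p ∣ [ p>0 ]) =
  value-injective (ℚₚ.1/-involutive p {{ℚₚ.pos⇒nonZero p {{p>0}}}})

-- `ℚ./` divides out a gcd; passing to unnormalised fractions with denominator 1 leaves only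
-- numerators to compare.
fromℕ⁺-suc : ∀ n → fromℕ⁺ (suc (suc n)) ≡ 1⁺ +⁺ fromℕ⁺ (suc n)
fromℕ⁺-suc n = value-injective (ℚₚ.toℚᵘ-injective (begin
  toℚᵘ (+ suc (suc n) ℚ./ 1)       ≈⟨ ℚₚ.toℚᵘ-fromℚᵘ (mkℚᵘ (+ suc (suc n)) 0) ⟩
  mkℚᵘ (+ suc (suc n)) 0           ≈⟨ ℚᵘₚ.≃-reflexive (cong (λ m → mkℚᵘ m 0) num) ⟩
  1ℚᵘ ℚᵘ.+ mkℚᵘ (+ suc n) 0        ≈⟨ ℚᵘₚ.+-congʳ 1ℚᵘ (ℚₚ.toℚᵘ-fromℚᵘ (mkℚᵘ (+ suc n) 0)) ⟨
  1ℚᵘ ℚᵘ.+ toℚᵘ (+ suc n ℚ./ 1)    ≈⟨ ℚₚ.toℚᵘ-homo-+ 1ℚ (+ suc n ℚ./ 1) ⟨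
  toℚᵘ (1ℚ ℚ.+ (+ suc n ℚ./ 1))    ∎))
  where
  open import Relation.Binary.Reasoning.Setoid ℚᵘₚ.≃-setoid
  num : + suc (suc n) ≡ + 1 ℤ.* + 1 ℤ.+ + suc n ℤ.* + 1
  num = cong (λ m → + 1 ℤ.+ m) (sym (ℤₚ.*-identityʳ (+ suc n)))

module _ {f : ℚ>0 → ℕ>0} (f-con : IsConumerator f) where
  open IsConumerator f-con

  -- Taking `X ≡ 1⁺ +⁺ Y` as an argument lets one rewriting of `X` serve both components of the
  -- pair.
  con-≡1+ : ∀ {X} Y → X ≡ 1⁺ +⁺ Y →
    value (f X) ≡ value (f Y) + value (f (1/⁺ Y)) × value (f (1/⁺ X)) ≡ value (f Y)
  con-≡1+ Y refl = at-1+ Y , at-1/1+ Y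

  con-fromℕ⁺ : ∀ n →
    value (f (fromℕ⁺ (suc n))) ≡ fib (suc (suc n)) ×
    value (f (1/⁺ fromℕ⁺ (suc n))) ≡ fib (suc n)
  con-fromℕ⁺ zero = at-1 , at-1
  con-fromℕ⁺ (suc n) =
    let num , den   = con-fromℕ⁺ n
        num⁺ , den⁺ = con-≡1+ (fromℕ⁺ (suc n)) (fromℕ⁺-suc n)
    in trans num⁺ (cong₂ _+_ num den) , trans den⁺ num

  -- The coefficients are the entries of the matrix (1 1; 1 0) raised to the power n + 1, one factor
  -- for each unit added.
  con-fromℕ⁺-+⁺ : ∀ n X → let a = value (f X); b = value (f (1/⁺ X)) in
    value (f (fromℕ⁺ (suc n) +⁺ X)) ≡ fib (suc (suc n)) * a + fib (suc n) * b ×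
    value (f (1/⁺ (fromℕ⁺ (suc n) +⁺ X))) ≡ fib (suc n) * a + fib n * b
  con-fromℕ⁺-+⁺ zero X =
    -- The coefficients here are 1, 1 and 1, 0, and `1 * a` unfolds to `a + 0`.
    trans (at-1+ X) (sym (cong₂ _+_ (+-identityʳ (value (f X))) (+-identityʳ (value (f (1/⁺ X)))))) ,
    trans (at-1/1+ X) (sym (trans (+-identityʳ _) (+-identityʳ _)))
  con-fromℕ⁺-+⁺ (suc n) X =
    let num , den   = con-fromℕ⁺-+⁺ n X
        num⁺ , den⁺ = con-≡1+ (fromℕ⁺ (suc n) +⁺ X)
          (trans (cong (_+⁺ X) (fromℕ⁺-suc n)) (+⁺-assoc 1⁺ (fromℕ⁺ (suc n)) X))
    in trans num⁺ (trans (cong₂ _+_ num den)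
         -- With `u`, `v`, `w` consecutive Fibonacci numbers, `u + v` and `v + w` are the next
         -- coefficients by the definition of `fib`.
         (solve 5 (λ u v w a b → (u :* a :+ v :* b) :+ (v :* a :+ w :* b)
                              := (u :+ v) :* a :+ (v :+ w) :* b) refl
           (fib (suc (suc n))) (fib (suc n)) (fib n) (value (f X)) (value (f (1/⁺ X))))) ,
       trans den⁺ num

lemma3p1 : (n₀ n₁ : ℕ) .{{_ : NonZero n₀}} .{{_ : NonZero n₁}} →
    value (F [ n₀ ⨾ n₁ ]) ≡ fib n₀ * fib n₁ + fib (n₀ ∸ 1) * fib (n₁ + 1)
lemma3p1 (suc n) (suc m) = begin
  value (F [ suc n ⨾ suc m ])
    -- `F` is `con` of the reciprocal, hence the second component, taken at X = 1/n₁.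
    ≡⟨ proj₂ (con-fromℕ⁺-+⁺ con-isConumerator n (1/⁺ M)) ⟩
  fib (suc n) * value (con (1/⁺ M)) + fib n * value (con (1/⁺ (1/⁺ M)))
    ≡⟨ cong (λ Y → fib (suc n) * value (con (1/⁺ M)) + fib n * value (con Y)) (1/⁺-involutive M) ⟩
  fib (suc n) * value (con (1/⁺ M)) + fib n * value (con M)
    ≡⟨ cong₂ (λ a b → fib (suc n) * a + fib n * b) (proj₂ con-M) (proj₁ con-M) ⟩
  fib (suc n) * fib (suc m) + fib n * fib (suc (suc m))
    ≡⟨ cong (λ k → fib (suc n) * fib (suc m) + fib n * fib k) (+-comm 1 (suc m)) ⟩
  fib (suc n) * fib (suc m) + fib n * fib (suc m + 1)
    ∎
  where
  open ≡-Reasoning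
  M = fromℕ⁺ (suc m)
  con-M = con-fromℕ⁺ con-isConumerator m
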